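{- Let $n\ge3$, $m=\lfloor n/2\rfloor$ and $\rho\in\mathrm{Par}_m$. Then $\mathrm{SST}_n^{\mathrm{AI}}(\rho)$ is an $\mathrm{AI}$-subcrystal of $\mathrm{SST}_n(\rho)$; that is, for every $T\in\mathrm{SST}_n^{\mathrm{AI}}(\rho)$ and $i\in\{1,\dots,n-1\}$, one has $\widetilde B_iT\in\mathrm{SST}_n^{\mathrm{AI}}(\rho)\sqcup\{0\}$.
   Context: $\mathrm{Par}_l$ is the set of partitions of length $\le l$. $\mathrm{SST}_n(\lambda)$ is the set of semistandard Young tableaux of shape $\lambda$ with entries in $\{1,\dots,n\}$; $d_j$ is the length of the $j$-th column of the diagram. For $\rho\in\mathrm{Par}_m$, $\mathrm{SST}_n^{\mathrm{AI}}(\rho)$ is the set of $T\in\mathrm{SST}_n(\rho)$ (entries $t_{i,j}$) with $t^c_{i,1}\le t_{i,2}$ for all $1\le i\le d_2$, where $t^c_{1,1}<\dots<t^c_{n-d_1,1}$ are the elements of $\{1,\dots,n\}\setminus\{t_{1,1},\dots,t_{d_1,1}\}$. The column reading $\mathrm{CR}(T)$ reads the columns left to right, each from bottom to top. For $i\in\{1,\dots,n-1\}$ and a word $w$, keep only letters $i,i+1$ and successively delete adjacent pairs $(i+1),i$ (an $i+1$ immediately left of an $i$ among the remaining letters) until $i^{a}(i+1)^{b}$ is left; $\varphi_i(w)=a$, $\varepsilon_i(w)=b$; $\widetilde F_i w$ changes the rightmost undeleted $i$ into $i+1$ ($0$ if $a=0$), $\widetilde E_iw$ changes the leftmost undeleted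 $i+1$ into $i$ ($0$ if $b=0$). For $T\in\mathrm{SST}_n(\lambda)$, $\varphi_i,\varepsilon_i$ are those of $\mathrm{CR}(T)$, and $\widetilde E_iT,\widetilde F_iT\in\mathrm{SST}_n(\lambda)\sqcup\{0\}$ are the tableaux of shape $\lambda$ (or $0$) with column readings $\widetilde E_i\mathrm{CR}(T),\widetilde F_i\mathrm{CR}(T)$. The $\mathrm{AI}$-crystal structure on $\mathrm{SST}_n(\lambda)$ is: $\deg_i(T)=\varepsilon_i(T)$, $\widetilde B_iT=\widetilde E_iT$ if $\varphi_i(T)$ is even; $\deg_i(T)=\varepsilon_i(T)+1$, $\widetilde B_iT=\widetilde F_iT$ if $\varphi_i(T)$ is odd. -}

module Defs where

open import Data.Bool.Base using (if_then_else_)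
open import Data.Fin.Base using (Fin)
open import Data.List.Base as List using (List; []; _∷_; length; filter; upTo; allFin)
open import Data.List.Relation.Binary.Prefix.Heterogeneous using (Prefix)
open import Data.List.Relation.Unary.All as All using (All; []; _∷_)
open import Data.List.Relation.Unary.Linked using (Linked)
open import Data.Maybe.Base as Maybe using (Maybe)
import Data.Maybe.Relation.Unary.All as MaybeAll
open import Data.Nat.Base using (ℕ; suc; _≤_; _<_; _≥_)
open import Data.Nat.ListAction using (sum)
open import Data.Nat.Divisibility using (_∣?_)
open import Data.Nat.Properties using (_≟_; _≤?_)
open import Data.List.Membership.DecPropositional _≟_ using (_∉?_)
open import Data.Product.Base using (_×_; _,_; ∃-syntax)
open import Data.Sum.Base using (_⊎_; inj₁; inj₂)
open import Data.Unit.Base using (⊤)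
open import Data.Vec.Base as Vec using (Vec; lookup; _[_]≔_)
open import Data.Vec.Properties using (reverse-involutive; take++drop≡id; ++-injective)
open import Function.Base using (_∘_)
open import Relation.Binary.Construct.Closure.ReflexiveTransitive using (Star; _◅_; _◅◅_; gmap)
  renaming (ε to done)
open import Relation.Binary.PropositionalEquality
open import Relation.Nullary.Decidable using (does; yes; no; _×-dec_; _⊎-dec_)
open import Relation.Nullary.Negation using (contradiction)
open import Relation.Unary using (Pred; Decidable)

[1…_] : ℕ → List ℕ
[1… n ] = List.map suc (upTo n)

record Partition : Set where
  field
    parts      : List ℕ
    decreasing : Linked _≥_ parts
    positive   : All (0 <_) parts

  largestPart : ℕ
  largestPart = Maybe.fromMaybe 0 (List.head parts)

  -- d₁ , d₂ , … : the j-th column of the diagram meets the rows i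
  -- with j ≤ λᵢ.
  columnLengths : List ℕ
  columnLengths = List.map (λ j → length (filter (j ≤?_) parts)) [1… largestPart ]

open Partition public

record Par (l : ℕ) : Set where
  field
    partition : Partition
    length≤   : length (parts partition) ≤ l

open Par public

-- A filling of the diagram with column lengths ds, given column by
-- column; each column is listed from top to bottom.
Filling : List ℕ → Set
Filling = All (Vec ℕ)

columns : ∀ {ds} → Filling ds → List (List ℕ)
columns = All.reduce Vec.toList

-- c ≼ (y₁ , … , y_d): the i-th entry of c is at most yᵢ for all
-- 1 ≤ i ≤ d (in particular c has at least d entries).
infix 4 _≼_
_≼_ : List ℕ → List ℕ → Set
c ≼ c′ = Prefix _≥_ c′ c

record IsSST (n : ℕ) {ds : List ℕ} (T : Filling ds) : Set where
  field
    letters       : All (All (λ t → 1 ≤ t × t ≤ n)) (columns T)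
    columnsStrict : All (Linked _<_) (columns T)
    rowsWeak      : Linked _≼_ (columns T)

-- The elements of {1, …, n} not in c, in increasing order.
complement : ℕ → List ℕ → List ℕ
complement n c = filter (_∉? c) [1… n ]

-- With fewer than two columns d₂ = 0 and the condition is void.
AICondition : ℕ → List (List ℕ) → Set
AICondition n (c₁ ∷ c₂ ∷ _) = complement n c₁ ≼ c₂
AICondition n _             = ⊤

SST : ℕ → (λ′ : Partition) → Pred (Filling (columnLengths λ′)) _
SST n λ′ T = IsSST n T

SST-AI : ℕ → (λ′ : Partition) → Pred (Filling (columnLengths λ′)) _
SST-AI n λ′ T = SST n λ′ T × AICondition n (columns T)

CR : ∀ {ds} → Filling ds → Vec ℕ (sum ds)
CR []       = Vec.[]
CR (c ∷ cs) = Vec.reverse c Vec.++ CR cs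

fromCR : ∀ ds → Vec ℕ (sum ds) → Filling ds
fromCR []       w = []
fromCR (d ∷ ds) w = Vec.reverse (Vec.take d w) ∷ fromCR ds (Vec.drop d w)

CR-fromCR : ∀ ds w → CR (fromCR ds w) ≡ w
CR-fromCR []       Vec.[] = refl
CR-fromCR (d ∷ ds) w      =
  trans (cong₂ Vec._++_ (reverse-involutive (Vec.take d w)) (CR-fromCR ds (Vec.drop d w)))
        (take++drop≡id d w)

CR-injective : ∀ {ds} (T T′ : Filling ds) → CR T ≡ CR T′ → T ≡ T′
CR-injective []      []        _  = refl
CR-injective (c ∷ T) (c′ ∷ T′) eq
  with ++-injective (Vec.reverse c) (Vec.reverse c′) eq
... | r≡r′ , w≡w′ = cong₂ _∷_
  (trans (sym (reverse-involutive c)) (trans (cong Vec.reverse r≡r′) (reverse-involutive c′)))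
  (CR-injective T T′ w≡w′)

-- Letters of a word are tracked by their positions, so that deletions do
-- not lose the place at which an operator acts.

module _ {L : ℕ} (i : ℕ) (w : Vec ℕ L) where

  is-i : Decidable (λ (p : Fin L) → lookup w p ≡ i)
  is-i p = lookup w p ≟ i

  is-i+1 : Decidable (λ (p : Fin L) → lookup w p ≡ suc i)
  is-i+1 p = lookup w p ≟ suc i

  kept : List (Fin L)
  kept = filter (λ p → is-i p ⊎-dec is-i+1 p) (allFin L)

  data _⟶_ : List (Fin L) → List (Fin L) → Set where
    delete : ∀ {p q ps} → lookup w p ≡ suc i → lookup w q ≡ i → (p ∷ q ∷ ps) ⟶ ps
    there  : ∀ {p ps qs} → ps ⟶ qs → (p ∷ ps) ⟶ (p ∷ qs)

  -- Put p in front of a word without deletable pairs, deleting the new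
  -- leading pair if it is (i+1), i.
  push : Fin L → List (Fin L) → List (Fin L)
  push p []       = p ∷ []
  push p (q ∷ qs) with is-i+1 p ×-dec is-i q
  ... | yes _ = qs
  ... | no  _ = p ∷ q ∷ qs

  deletePairs : List (Fin L) → List (Fin L)
  deletePairs = List.foldr push []

  undeleted : List (Fin L)
  undeleted = deletePairs kept

  undeleted-i : List (Fin L)
  undeleted-i = filter is-i undeleted

  undeleted-i+1 : List (Fin L)
  undeleted-i+1 = filter is-i+1 undeleted

  φʷ : ℕ
  φʷ = length undeleted-i

  εʷ : ℕ
  εʷ = length undeleted-i+1

  -- In results of operators, nothing stands for 0.
  F̃ʷ : Maybe (Vec ℕ L)
  F̃ʷ = Maybe.map (λ p → w [ p ]≔ suc i) (List.last undeleted-i)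

  Ẽʷ : Maybe (Vec ℕ L)
  Ẽʷ = Maybe.map (λ p → w [ p ]≔ i) (List.head undeleted-i+1)

  -- deletePairs only deletes adjacent pairs (i+1), i, and what is left
  -- of the letters i, i+1 has the form i^a (i+1)^b.

  deletePairs-⟶ : ∀ ps → Star _⟶_ ps (deletePairs ps)
  deletePairs-⟶ []       = done
  deletePairs-⟶ (p ∷ ps) =
    gmap (p ∷_) there (deletePairs-⟶ ps) ◅◅ push-⟶ (deletePairs ps)
    where
    push-⟶ : ∀ qs → Star _⟶_ (p ∷ qs) (push p qs)
    push-⟶ []       = done
    push-⟶ (q ∷ qs) with is-i+1 p ×-dec is-i q
    ... | yes (p≡ , q≡) = delete p≡ q≡ ◅ done
    ... | no  _         = done

  Reduced : List (Fin L) → Set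
  Reduced ps = ∃[ as ] ∃[ bs ] ps ≡ as List.++ bs
    × All (λ p → lookup w p ≡ i) as × All (λ p → lookup w p ≡ suc i) bs

  deletePairs-reduced : ∀ {ps} → All (λ p → lookup w p ≡ i ⊎ lookup w p ≡ suc i) ps →
                        Reduced (deletePairs ps)
  deletePairs-reduced []         = [] , [] , refl , [] , []
  deletePairs-reduced (pi ∷ pis) = push-reduced pi (deletePairs-reduced pis)
    where
    push-reduced : ∀ {p qs} → lookup w p ≡ i ⊎ lookup w p ≡ suc i →
                   Reduced qs → Reduced (push p qs)
    push-reduced {p} (inj₁ p≡) ([] , [] , refl , _ , _) = p ∷ [] , [] , refl , p≡ ∷ [] , []
    push-reduced {p} (inj₂ p≡) ([] , [] , refl , _ , _) = [] , p ∷ [] , refl , [] , p≡ ∷ []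
    push-reduced {p} p∈ ([] , b ∷ bs , refl , _ , b≡ ∷ bs≡) with is-i+1 p ×-dec is-i b
    push-reduced {p} p∈ ([] , b ∷ bs , refl , _ , b≡ ∷ bs≡) | yes _ = [] , bs , refl , [] , bs≡
    push-reduced {p} (inj₁ p≡) ([] , b ∷ bs , refl , _ , b≡ ∷ bs≡) | no _ =
      p ∷ [] , b ∷ bs , refl , p≡ ∷ [] , b≡ ∷ bs≡
    push-reduced {p} (inj₂ p≡) ([] , b ∷ bs , refl , _ , b≡ ∷ bs≡) | no _ =
      [] , p ∷ b ∷ bs , refl , [] , p≡ ∷ b≡ ∷ bs≡
    push-reduced {p} p∈ (a ∷ as , bs , refl , a≡ ∷ as≡ , bs≡) with is-i+1 p ×-dec is-i a
    push-reduced {p} p∈ (a ∷ as , bs , refl , a≡ ∷ as≡ , bs≡) | yes _ = as , bs , refl , as≡ , bs≡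
    push-reduced {p} (inj₁ p≡) (a ∷ as , bs , refl , a≡ ∷ as≡ , bs≡) | no _ =
      p ∷ a ∷ as , bs , refl , p≡ ∷ a≡ ∷ as≡ , bs≡
    push-reduced {p} (inj₂ p≡) (a ∷ as , bs , refl , a≡ ∷ as≡ , bs≡) | no ¬pair =
      contradiction (p≡ , a≡) ¬pair

module _ {ds : List ℕ} (i : ℕ) (T : Filling ds) where

  φ : ℕ
  φ = φʷ i (CR T)

  ε : ℕ
  ε = εʷ i (CR T)

  Ẽ : Maybe (Filling ds)
  Ẽ = Maybe.map (fromCR ds) (Ẽʷ i (CR T))

  F̃ : Maybe (Filling ds)
  F̃ = Maybe.map (fromCR ds) (F̃ʷ i (CR T))

  deg : ℕ
  deg = if does (2 ∣? φ) then ε else suc ε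

  B̃ : Maybe (Filling ds)
  B̃ = if does (2 ∣? φ) then Ẽ else F̃

-- Here nothing, i.e. 0, always satisfies P ⊔0.
_⊔0 : ∀ {a ℓ} {A : Set a} → Pred A ℓ → Pred (Maybe A) _
_⊔0 = MaybeAll.All

{-# OPTIONS --safe #-}

-- An operator acts on a letter y ∈ {i, i + 1} of CR T = u y v such that u
-- reduces to i^a and v to (i + 1)^b; moreover a = φ for Ẽ and a = φ - 1 for F̃.
-- So the column of y contains only one of i, i + 1. If F̃ broke a row, then the
-- next column would contain i but not i + 1, leaving an i in v; if Ẽ broke a
-- row, then the previous column would contain i + 1 but not i, leaving an
-- i + 1 in u. The operators exchange i and i + 1 in the complement of the first
-- column, so F̃ can only weaken the AI-condition. If Ẽ acts on the first column
-- and breaks it, then again the second column contains i but not i + 1; if Ẽ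
-- acts on the second column and breaks it, then the first column contains i but
-- not i + 1, so that φ = a = 1, but Ẽ is only applied for even φ.
module Submission where

open import Defs
open import Data.Bool.Base using (if_then_else_)
open import Data.Fin.Base as Fin using (Fin)
open import Data.List.Base
  using (List; []; _∷_; _++_; _∷ʳ_; [_]; length; map; filter; reverse; head; last; allFin; applyUpTo; tabulate)
open import Data.List.Properties
open import Data.List.Membership.Propositional renaming (_∈_ to _∈ˡ_; _∉_ to _∉ˡ_)
open import Data.List.Membership.Propositional.Properties
open import Data.List.Relation.Binary.Prefix.Heterogeneous using ([]; _∷_)
open import Data.List.Relation.Unary.All as All using (All; []; _∷_)
import Data.List.Relation.Unary.All.Properties as All
open import Data.List.Relation.Unary.AllPairs using (AllPairs; []; _∷_)
open import Data.List.Relation.Unary.Any using (here; there)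
import Data.List.Relation.Unary.Any.Properties as Any
open import Data.List.Relation.Unary.Linked as Linked using (Linked; []; [-]; _∷_)
import Data.List.Relation.Unary.Linked.Properties as Linked
open import Data.Maybe.Base as Maybe using (Maybe)
import Data.Maybe.Relation.Unary.All as MaybeAll
import Data.Maybe.Relation.Unary.All.Properties as MaybeAll
open import Data.Nat.Base using (ℕ; zero; suc; pred; _+_; _≤_; _<_; _≥_; _/_; z≤n; s≤s; s≤s⁻¹)
open import Data.Nat.Divisibility using (_∣_; _∣?_; ∣1⇒≡1)
open import Data.Nat.Properties
open import Data.List.Membership.DecPropositional _≟_ using (_∈?_; _∉?_)
open import Data.Product.Base using (_×_; _,_; proj₁; proj₂; ∃₂; ∃-syntax)
open import Data.Sum.Base using (_⊎_; inj₁; inj₂)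
open import Data.Unit.Base using (tt)
open import Data.Vec.Base as Vec using (Vec; lookup; _[_]≔_)
import Data.Vec.Properties as Vec
open import Function.Base using (_∘_; id)
open import Relation.Binary.Core using (Rel)
open import Relation.Binary.PropositionalEquality hiding ([_])
open import Relation.Nullary.Decidable using (Dec; does; yes; no; _×-dec_; _⊎-dec_; decidable-stable)
open import Relation.Nullary.Negation using (¬_; contradiction)
open import Relation.Unary using (Pred; Decidable; _∈_)

-- Lists and columns with one distinguished entry.

module _ {a p q} {A : Set a} {P : Pred A p} {Q : Pred A q} (P? : Decidable P) (Q? : Decidable Q) where

  filter-cong : ∀ {xs} → All (λ x → (P x → Q x) × (Q x → P x)) xs → filter P? xs ≡ filter Q? xs
  filter-cong []                              = refl
  filter-cong {x ∷ xs} ((p⇒q , q⇒p) ∷ es) with P? x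
  ... | yes px = trans (cong (x ∷_) (filter-cong es)) (sym (filter-accept Q? (p⇒q px)))
  ... | no ¬px = trans (filter-cong es) (sym (filter-reject Q? (¬px ∘ q⇒p)))

module _ {a b p} {A : Set a} {B : Set b} {P : Pred B p} (P? : Decidable P) (f : A → B) where

  filter-map : ∀ xs → filter P? (map f xs) ≡ map f (filter (P? ∘ f) xs)
  filter-map []       = refl
  filter-map (x ∷ xs) with P? (f x)
  ... | yes _ = cong (f x ∷_) (filter-map xs)
  ... | no  _ = filter-map xs

++-cancel-length : ∀ {a} {A : Set a} (xs xs′ : List A) {ys ys′} → length xs ≡ length xs′ →
                   xs ++ ys ≡ xs′ ++ ys′ → xs ≡ xs′ × ys ≡ ys′
++-cancel-length []       []         _   eq = refl , eq
++-cancel-length (x ∷ xs) (x′ ∷ xs′) len eq with ∷-injective eq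
... | refl , eq′ with ++-cancel-length xs xs′ (suc-injective len) eq′
...   | refl , ys≡ = refl , ys≡

applyUpTo-++ : ∀ {a} {A : Set a} (f : ℕ → A) m n →
               applyUpTo f (m + n) ≡ applyUpTo f m ++ applyUpTo (f ∘ (m +_)) n
applyUpTo-++ f zero    n = refl
applyUpTo-++ f (suc m) n = cong (f 0 ∷_) (applyUpTo-++ (f ∘ suc) m n)

reverse-++-∷ : ∀ {a} {A : Set a} (xs : List A) y ys →
               reverse (xs ++ y ∷ ys) ≡ reverse ys ++ y ∷ reverse xs
reverse-++-∷ xs y ys = begin
  reverse (xs ++ y ∷ ys)            ≡⟨ reverse-++ xs (y ∷ ys) ⟩
  reverse (y ∷ ys) ++ reverse xs    ≡⟨ cong (_++ reverse xs) (unfold-reverse y ys) ⟩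
  (reverse ys ∷ʳ y) ++ reverse xs   ≡⟨ ++-assoc (reverse ys) [ y ] (reverse xs) ⟩
  reverse ys ++ y ∷ reverse xs      ∎
  where open ≡-Reasoning

All-reverse : ∀ {a p} {A : Set a} {P : Pred A p} {xs} → All P xs → All P (reverse xs)
All-reverse {xs = xs} pxs = All.tabulate (All.lookup pxs ∘ Any.reverse⁻)

module _ {a r} {A : Set a} {R : Rel A r} where

  -- Only the relations with the two neighbours of the changed entry are affected: the left
  -- neighbour is the last element of `xs`, the right one the head of `ys`.
  Linked-replace : ∀ {x x′ ys} xs → Linked R (xs ++ x ∷ ys) →
                   (∀ {ws w} → xs ≡ ws ∷ʳ w → R w x → R w x′) →
                   (∀ {z zs} → ys ≡ z ∷ zs → R x z → R x′ z) →
                   Linked R (xs ++ x′ ∷ ys)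
  Linked-replace []            [-]      _ _ = [-]
  Linked-replace []            (r ∷ rs) _ g = g refl r ∷ rs
  Linked-replace (w ∷ [])      (r ∷ rs) f g = f {[]} refl r ∷ 
    Linked-replace [] rs (λ { {[]} () ; {_ ∷ _} () }) g
  Linked-replace (w ∷ v ∷ xs)  (r ∷ rs) f g = r ∷
    Linked-replace (v ∷ xs) rs (λ {ws} eq → f {w ∷ ws} (cong (w ∷_) eq)) g

strict-split : ∀ xs {y ys} → Linked _<_ (xs ++ y ∷ ys) →
               All (_< y) xs × All (y <_) ys × Linked _<_ xs × Linked _<_ ys
strict-split xs l with go xs (Linked.Linked⇒AllPairs <-trans l)
  where
  go : ∀ xs {y ys} → AllPairs _<_ (xs ++ y ∷ ys) →
       All (_< y) xs × All (y <_) ys × AllPairs _<_ xs × AllPairs _<_ ys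
  go []       (ys> ∷ ps) = [] , ys> , [] , ps
  go (x ∷ xs) (xs> ∷ ps) with go xs ps | All.++⁻ xs xs>
  ... | xs< , ys> , pxs , pys | x<xs , x<y ∷ _ = x<y ∷ xs< , ys> , x<xs ∷ pxs , pys
... | xs< , ys> , pxs , pys = xs< , ys> , Linked.AllPairs⇒Linked pxs , Linked.AllPairs⇒Linked pys

-- Since `c` is at least as long as the right column, it has an entry `z` in the row of `y`. The
-- last component records that `z` is all that bounds a replacement for `y` from below.
≼-splitˡ : ∀ {c} X {y Y} → c ≼ X ++ y ∷ Y →
           ∃₂ λ X′ z → ∃[ Y′ ] c ≡ X′ ++ z ∷ Y′ × z ≤ y ×
           (∀ {k} → All (_< k) X → All (_< k) X′) ×
           (∀ {y′} → z ≤ y′ → c ≼ X ++ y′ ∷ Y)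
≼-splitˡ []      (z≤y ∷ r) = [] , _ , _ , refl , z≤y , (λ _ → []) , (_∷ r)
≼-splitˡ (x ∷ X) (w≤x ∷ r) with ≼-splitˡ X r
... | X′ , z , Y′ , refl , z≤y , X′< , repl =
  _ ∷ X′ , z , Y′ , refl , z≤y ,
  (λ { (x<k ∷ X<k) → ≤-<-trans w≤x x<k ∷ X′< X<k }) , (w≤x ∷_) ∘ repl

-- The right column may end above the row of `y`, which leaves `y` unconstrained; otherwise its
-- entry `z` in that row is the only upper bound.
≼-splitʳ : ∀ {c} X {y Y} → X ++ y ∷ Y ≼ c →
           (∀ {y′} → X ++ y′ ∷ Y ≼ c) ⊎
           (∃₂ λ X′ z → ∃[ Y′ ] c ≡ X′ ++ z ∷ Y′ × y ≤ z × Y ≼ Y′ ×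
           (∀ {y′} → y′ ≤ z → X ++ y′ ∷ Y ≼ c))
≼-splitʳ []      []        = inj₁ []
≼-splitʳ []      (y≤z ∷ r) = inj₂ ([] , _ , _ , refl , y≤z , r , (_∷ r))
≼-splitʳ (x ∷ X) []        = inj₁ []
≼-splitʳ (x ∷ X) (x≤w ∷ r) with ≼-splitʳ X r
... | inj₁ repl = inj₁ (x≤w ∷ repl)
... | inj₂ (X′ , z , Y′ , refl , y≤z , Y≼Y′ , repl) =
  inj₂ (_ ∷ X′ , z , Y′ , refl , y≤z , Y≼Y′ , (x≤w ∷_) ∘ repl)

All-replace : ∀ {a p} {A : Set a} {P : Pred A p} xs {x x′ ys} →
              All P (xs ++ x ∷ ys) → P x′ → All P (xs ++ x′ ∷ ys)
All-replace []       (_ ∷ pxs)  px′ = px′ ∷ pxs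
All-replace (w ∷ xs) (px ∷ pxs) px′ = px ∷ All-replace xs pxs px′

All-middle : ∀ {a p} {A : Set a} {P : Pred A p} xs {x ys} → All P (xs ++ x ∷ ys) → P x
All-middle xs = All.head ∘ All.++⁻ʳ xs

-- The left column is the longer one, so every entry of `Y` has an entry of `X` beside it.
≼-All-> : ∀ {k X Y} → X ≼ Y → All (k <_) X → All (k <_) Y
≼-All-> []        _           = []
≼-All-> (x≤y ∷ r) (k<x ∷ X>k) = <-≤-trans k<x x≤y ∷ ≼-All-> r X>k

-- The interval from 1 to `n` and complements of columns.

[1…]-strict : ∀ n → Linked _<_ [1… n ]
[1…]-strict n = subst (Linked _<_) (sym (map-upTo suc n)) (Linked.applyUpTo⁺₂ suc n (λ _ → n<1+n _))

∈-[1…] : ∀ {i n} → 1 ≤ i → i ≤ n → i ∈ˡ [1… n ]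
∈-[1…] (s≤s _) i≤n = ∈-map⁺ suc (∈-upTo⁺ i≤n)

[1…]-split : ∀ {i n} → 1 ≤ i → i < n →
             ∃₂ λ X Y → [1… n ] ≡ X ++ i ∷ suc i ∷ Y × All (_< i) X × All (suc i <_) Y
-- With `i = suc k` the length is `2 + k + m`: `k` numbers before `i`, the pair itself, and `m`
-- numbers after it.
[1…]-split {suc k} (s≤s _) i<n with m≤n⇒∃[o]m+o≡n i<n
... | m , refl = applyUpTo suc k , applyUpTo (λ x → suc (k + (2 + x))) m , eq ,
                 All.applyUpTo⁺₁ suc k s≤s ,
                 All.applyUpTo⁺₂ _ m (λ x → s≤s (≤-trans (≤-reflexive (+-comm 2 k)) (+-monoʳ-≤ k (s≤s (s≤s z≤n)))))
  where
  open ≡-Reasoning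
  eq : [1… 2 + k + m ] ≡ applyUpTo suc k ++ suc k ∷ 2 + k ∷ applyUpTo (λ x → suc (k + (2 + x))) m
  eq = begin
    [1… 2 + k + m ]                  ≡⟨ map-upTo suc (2 + k + m) ⟩
    applyUpTo suc (2 + k + m)        ≡⟨ cong (λ n → applyUpTo suc (n + m)) (+-comm 2 k) ⟩
    applyUpTo suc (k + 2 + m)        ≡⟨ cong (applyUpTo suc) (+-assoc k 2 m) ⟩
    applyUpTo suc (k + (2 + m))      ≡⟨ applyUpTo-++ suc k (2 + m) ⟩
    applyUpTo suc k ++ suc (k + 0) ∷ suc (k + 1) ∷ applyUpTo (λ x → suc (k + (2 + x))) m
      ≡⟨ cong₂ (λ x y → applyUpTo suc k ++ suc x ∷ suc y ∷ applyUpTo (λ x → suc (k + (2 + x))) m)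
           (+-identityʳ k) (+-comm k 1) ⟩
    applyUpTo suc k ++ suc k ∷ 2 + k ∷ applyUpTo (λ x → suc (k + (2 + x))) m ∎

-- Two words with first blocks of equal length differ in one letter. That letter lies in the first
-- block, and then the remainders agree, or it lies in the remainder, and then the first blocks
-- agree.
++-split₂ : ∀ {a} {A : Set a} (xs xs′ : List A) {ys ys′} u {y y′ v} → length xs ≡ length xs′ →
            xs ++ ys ≡ u ++ y ∷ v → xs′ ++ ys′ ≡ u ++ y′ ∷ v →
            (∃[ t ] xs ≡ u ++ y ∷ t × xs′ ≡ u ++ y′ ∷ t × v ≡ t ++ ys × ys ≡ ys′) ⊎
            (∃[ t ] xs ≡ xs′ × u ≡ xs ++ t × ys ≡ t ++ y ∷ v × ys′ ≡ t ++ y′ ∷ v)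
++-split₂ []       []         u       _   eq   eq′  = inj₂ (u , refl , refl , eq , eq′)
++-split₂ (x ∷ xs) (x′ ∷ xs′) []      len refl eq′  with ∷-injective eq′
... | refl , tail-eq = inj₁ (xs , refl , cong (_ ∷_) (proj₁ xs′≡ys′) , refl , sym (proj₂ xs′≡ys′))
  where xs′≡ys′ = ++-cancel-length xs′ xs (sym (suc-injective len)) tail-eq
++-split₂ (x ∷ xs) (x′ ∷ xs′) (z ∷ u) len eq   eq′  with ∷-injective eq | ∷-injective eq′
... | refl , e | refl , e′ with ++-split₂ xs xs′ u (suc-injective len) e e′
...   | inj₁ (t , refl , refl , v≡ , ys≡) = inj₁ (t , refl , refl , v≡ , ys≡)
...   | inj₂ (t , refl , refl , ys≡ , ys′≡) = inj₂ (t , refl , refl , ys≡ , ys′≡)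

complement-strict : ∀ n c → Linked _<_ (complement n c)
complement-strict n c = Linked.filter⁺ (_∉? c) <-trans ([1…]-strict n)

-- As `i` and `i + 1` are consecutive and exactly one of them is in the column, the other one is in
-- the complement, at the same place in both cases. Here `γ` and `δ` are the missing numbers below
-- `i` and above `i + 1`.
complement-swap : ∀ {n i α β} → 1 ≤ i → i < n → All (_< i) α → All (suc i <_) β →
                  ∃₂ λ γ δ → complement n (α ++ i ∷ β) ≡ γ ++ suc i ∷ δ ×
                             complement n (α ++ suc i ∷ β) ≡ γ ++ i ∷ δ × All (suc i <_) δ
complement-swap {n} {i} {α} {β} 1≤i i<n α< β> with [1…]-split 1≤i i<n
... | X , Y , eq , X< , Y> =
  filter (_∉? (α ++ β)) X , filter (_∉? (α ++ β)) Y ,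
  (begin
    filter (_∉? (α ++ i ∷ β)) [1… n ]                       ≡⟨ split (α ++ i ∷ β) ⟩
    filter (_∉? (α ++ i ∷ β)) X ++ filter (_∉? (α ++ i ∷ β)) (i ∷ suc i ∷ Y)
      ≡⟨ cong₂ _++_ (same X (All.map <⇒≢ X<))
           (trans (filter-reject (_∉? (α ++ i ∷ β)) (λ i∉ → i∉ (∈-++⁺ʳ α (here refl))))
           (trans (filter-accept (_∉? (α ++ i ∷ β)) i+1∉)
                  (cong (suc i ∷_) (same Y (All.map (>⇒≢ ∘ <-trans (n<1+n i)) Y>))))) ⟩
    filter (_∉? (α ++ β)) X ++ suc i ∷ filter (_∉? (α ++ β)) Y ∎) ,
  (begin
    filter (_∉? (α ++ suc i ∷ β)) [1… n ]                       ≡⟨ split (α ++ suc i ∷ β) ⟩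
    filter (_∉? (α ++ suc i ∷ β)) X ++ filter (_∉? (α ++ suc i ∷ β)) (i ∷ suc i ∷ Y)
      ≡⟨ cong₂ _++_ (same X (All.map (<⇒≢ ∘ m<n⇒m<1+n) X<))
           (trans (filter-accept (_∉? (α ++ suc i ∷ β)) i∉)
                  (cong (i ∷_) (trans (filter-reject (_∉? (α ++ suc i ∷ β)) (λ i∉ → i∉ (∈-++⁺ʳ α (here refl))))
                                      (same Y (All.map >⇒≢ Y>))))) ⟩
    filter (_∉? (α ++ β)) X ++ i ∷ filter (_∉? (α ++ β)) Y ∎) ,
  All.tabulate (All.lookup Y> ∘ proj₁ ∘ ∈-filter⁻ (_∉? (α ++ β)))
  where
  open ≡-Reasoning

  split : ∀ c → complement n c ≡ filter (_∉? c) X ++ filter (_∉? c) (i ∷ suc i ∷ Y)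
  split c = trans (cong (filter (_∉? c)) eq) (filter-++ (_∉? c) X (i ∷ suc i ∷ Y))

  drop-∉ : ∀ {x y} → x ≢ y → (x ∉ˡ α ++ y ∷ β → x ∉ˡ α ++ β) × (x ∉ˡ α ++ β → x ∉ˡ α ++ y ∷ β)
  drop-∉ {x} {y} x≢y = (λ x∉ → x∉ ∘ weaken) , (λ x∉ → x∉ ∘ strengthen)
    where
    weaken : x ∈ˡ α ++ β → x ∈ˡ α ++ y ∷ β
    weaken x∈ with ∈-++⁻ α x∈
    ... | inj₁ ∈α = ∈-++⁺ˡ ∈α
    ... | inj₂ ∈β = ∈-++⁺ʳ α (there ∈β)
    strengthen : x ∈ˡ α ++ y ∷ β → x ∈ˡ α ++ β
    strengthen x∈ with ∈-++⁻ α x∈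
    ... | inj₁ ∈α          = ∈-++⁺ˡ ∈α
    ... | inj₂ (here x≡y)  = contradiction x≡y x≢y
    ... | inj₂ (there ∈β)  = ∈-++⁺ʳ α ∈β

  same : ∀ {y} xs → All (_≢ y) xs → filter (_∉? (α ++ y ∷ β)) xs ≡ filter (_∉? (α ++ β)) xs
  same {y} xs ≢y = filter-cong (_∉? (α ++ y ∷ β)) (_∉? (α ++ β)) (All.map drop-∉ ≢y)

  i∉ : i ∉ˡ α ++ suc i ∷ β
  i∉ i∈ with ∈-++⁻ α i∈
  ... | inj₁ ∈α          = <-irrefl refl (All.lookup α< ∈α)
  ... | inj₂ (here i≡)   = 1+n≢n (sym i≡)
  ... | inj₂ (there ∈β)  = <-asym (n<1+n i) (All.lookup β> ∈β)

  i+1∉ : suc i ∉ˡ α ++ i ∷ β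
  i+1∉ i∈ with ∈-++⁻ α i∈
  ... | inj₁ ∈α          = <-asym (n<1+n i) (All.lookup α< ∈α)
  ... | inj₂ (here i≡)   = 1+n≢n i≡
  ... | inj₂ (there ∈β)  = <-irrefl refl (All.lookup β> ∈β)

-- Signatures of words.

module _ (i : ℕ) where

  -- Signature w a b: deleting pairs (i + 1) i from w leaves i^a (i + 1)^b.
  data Signature : List ℕ → ℕ → ℕ → Set where
    []     : Signature [] 0 0
    lower  : ∀ {w a b} → Signature w a b → Signature (i ∷ w) (suc a) b
    cancel : ∀ {w a b} → Signature w (suc a) b → Signature (suc i ∷ w) a b
    raise  : ∀ {w b} → Signature w 0 b → Signature (suc i ∷ w) 0 (suc b)
    skip   : ∀ {x w a b} → x ≢ i → x ≢ suc i → Signature w a b → Signature (x ∷ w) a b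

  Neutral : ℕ → Set
  Neutral x = x ≢ i × x ≢ suc i

  neutral-< : ∀ {xs} → All (_< i) xs → All Neutral xs
  neutral-< = All.map (λ x<i → <⇒≢ x<i , <⇒≢ (m<n⇒m<1+n x<i))

  neutral-> : ∀ {xs} → All (suc i <_) xs → All Neutral xs
  neutral-> = All.map (λ i+1<x → >⇒≢ (<-trans (n<1+n i) i+1<x) , >⇒≢ i+1<x)

  signature-neutral : ∀ {w a b} → All Neutral w → Signature w a b → a ≡ 0
  signature-neutral []                [] = refl
  signature-neutral ((≢i , _) ∷ _)    (lower s) = contradiction refl ≢i
  signature-neutral ((_ , ≢i+1) ∷ _)  (cancel s) = contradiction refl ≢i+1
  signature-neutral ((_ , ≢i+1) ∷ _)  (raise s) = contradiction refl ≢i+1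
  signature-neutral (_ ∷ ns)          (skip _ _ s) = signature-neutral ns s

  -- No `i + 1` precedes this `i`, so nothing can delete it and the count of undeleted `i` is
  -- positive.
  undeleted-lower : ∀ {x y b} → All Neutral x → ¬ Signature (x ++ i ∷ y) 0 b
  undeleted-lower []               (skip ≢i _ _) = ≢i refl
  undeleted-lower ((_ , ≢i+1) ∷ _) (cancel s)    = ≢i+1 refl
  undeleted-lower ((_ , ≢i+1) ∷ _) (raise s)     = ≢i+1 refl
  undeleted-lower (_ ∷ ns)         (skip _ _ s)  = undeleted-lower ns s

  -- No `i` follows this `i + 1`, so nothing can delete it.
  undeleted-raise : ∀ x {y a} → All Neutral y → ¬ Signature (x ++ suc i ∷ y) a 0
  undeleted-raise [] ns (cancel s) = contradiction (signature-neutral ns s) λ()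
  undeleted-raise [] ns (skip _ ≢i+1 _) = ≢i+1 refl
  undeleted-raise (_ ∷ x) ns (lower s) = undeleted-raise x ns s
  undeleted-raise (_ ∷ x) ns (cancel s) = undeleted-raise x ns s
  undeleted-raise (_ ∷ x) ns (skip _ _ s) = undeleted-raise x ns s

  -- Meant for the entries `α` above an `i + 1` that `Ẽ` lowers. The reading meets them right after
  -- that letter, from bottom to top, so an `i` among them would have no `i + 1` before it to cancel
  -- with.
  signature-lowers-< : ∀ {α y b} → Linked _<_ α → All (_< suc i) α →
                       Signature (reverse α ++ y) 0 b → All (_< i) α
  signature-lowers-< {α} {y} {b} l α≤ s =
    All.tabulate (λ x∈ → ≤∧≢⇒< (s≤s⁻¹ (All.lookup α≤ x∈)) (λ { refl → i∉α x∈ }))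
    where
    i∉α : i ∉ˡ α
    i∉α i∈ with ∈-∃++ i∈
    ... | α₁ , α₂ , refl with strict-split α₁ l | All.++⁻ʳ α₁ α≤
    ...   | _ , α₂> , _ | _ ∷ α₂≤ = undeleted-lower {y = reverse α₁ ++ y} neutral
            (subst (λ w → Signature w 0 b)
              (trans (cong (_++ y) (reverse-++-∷ α₁ i α₂)) (++-assoc (reverse α₂) (i ∷ reverse α₁) y)) s)
      where
      neutral : All Neutral (reverse α₂)
      neutral = All-reverse (All.zipWith (λ (i<x , x<i+1) → >⇒≢ i<x , <⇒≢ x<i+1) (α₂> , α₂≤))

  -- The mirror image, for the entries `β` below an `i` that `F̃` raises: they are read right before
  -- it, and an `i + 1` among them would have no `i` after it.
  signature-raises-> : ∀ u {β a} → Linked _<_ β → All (i <_) β →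
                       Signature (u ++ reverse β) a 0 → All (suc i <_) β
  signature-raises-> u {β} {a} l β≥ s =
    All.tabulate (λ x∈ → ≤∧≢⇒< (All.lookup β≥ x∈) (λ { refl → i+1∉β x∈ }))
    where
    i+1∉β : suc i ∉ˡ β
    i+1∉β i∈ with ∈-∃++ i∈
    ... | β₁ , β₂ , refl with strict-split β₁ l | All.++⁻ˡ β₁ β≥
    ...   | β₁< , _ | β₁≥ = undeleted-raise (u ++ reverse β₂) neutral
            (subst (λ w → Signature w a 0)
              (trans (cong (u ++_) (reverse-++-∷ β₁ (suc i) β₂)) (sym (++-assoc u (reverse β₂) _))) s)
      where
      neutral : All Neutral (reverse β₁)
      neutral = All-reverse (All.zipWith (λ (i<x , x<i+1) → >⇒≢ i<x , <⇒≢ x<i+1) (β₁≥ , β₁<))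

  -- This is the source of the parity argument: a word whose only relevant letter is a single `i`
  -- has an odd number of undeleted `i`.
  signature-single-lower : ∀ {x y a b} → All Neutral x → All Neutral y →
                           Signature (x ++ i ∷ y) a b → a ≡ 1
  signature-single-lower []               ns (lower s)     = cong suc (signature-neutral ns s)
  signature-single-lower []               ns (skip ≢i _ _) = contradiction refl ≢i
  signature-single-lower ((≢i , _) ∷ _)   ns (lower s)     = contradiction refl ≢i
  signature-single-lower ((_ , ≢i+1) ∷ _) ns (cancel s)    = contradiction refl ≢i+1
  signature-single-lower ((_ , ≢i+1) ∷ _) ns (raise s)     = contradiction refl ≢i+1
  signature-single-lower (_ ∷ ms)         ns (skip _ _ s)  = signature-single-lower ms ns s

  -- The letter y at position p of w has no undeleted i to its right and no
  -- undeleted i + 1 to its left, whereas a letters i to its left are undeleted.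
  Exposed : ∀ {L} → Vec ℕ L → Fin L → ℕ → ℕ → Set
  Exposed w p y a = ∃₂ λ u v → ∃[ b ] Vec.toList w ≡ u ++ y ∷ v
    × (∀ y′ → Vec.toList (w [ p ]≔ y′) ≡ u ++ y′ ∷ v)
    × Signature u a 0 × Signature v 0 b

  -- The facts are bundled for one induction over the word, because a letter put in front changes
  -- the undeleted positions, the signature and the exposure counts together.
  record Analysis {L} (w : Vec ℕ L) : Set where
    field
      lowers raises : List (Fin L)
      undeleted-≡   : undeleted i w ≡ lowers ++ raises
      all-lower     : All (λ p → lookup w p ≡ i) lowers
      all-raise     : All (λ p → lookup w p ≡ suc i) raises
      signature     : Signature (Vec.toList w) (length lowers) (length raises)
      -- The last undeleted `i` has all the others to its left but not itself, hence `pred`; the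
      -- first undeleted `i + 1` has all of them to its left.
      last-lower    : MaybeAll.All (λ p → Exposed w p i (pred (length lowers))) (last lowers)
      head-raise    : MaybeAll.All (λ p → Exposed w p (suc i) (length lowers)) (head raises)

  -- Undeleted positions after a letter is put in front.

  module _ {L} (x : ℕ) (w : Vec ℕ L) where

    -- Shifting positions by `Fin.suc` keeps the letters found there, so deletion commutes with the
    -- shift.
    push-suc : ∀ p qs → push i (x Vec.∷ w) (Fin.suc p) (map Fin.suc qs) ≡ map Fin.suc (push i w p qs)
    push-suc p []       = refl
    push-suc p (q ∷ qs) with is-i+1 i w p ×-dec is-i i w q
    ... | yes _ = refl
    ... | no  _ = refl

    deletePairs-suc : ∀ ps → deletePairs i (x Vec.∷ w) (map Fin.suc ps) ≡ map Fin.suc (deletePairs i w ps)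
    deletePairs-suc []       = refl
    deletePairs-suc (p ∷ ps) = trans (cong (push i (x Vec.∷ w) (Fin.suc p)) (deletePairs-suc ps))
                                     (push-suc p (deletePairs i w ps))

    private
      is-kept : ∀ {L} (w : Vec ℕ L) → Decidable (λ p → lookup w p ≡ i ⊎ lookup w p ≡ suc i)
      is-kept w p = is-i i w p ⊎-dec is-i+1 i w p

      kept-suc : filter (is-kept (x Vec.∷ w)) (tabulate Fin.suc) ≡ map Fin.suc (kept i w)
      kept-suc = trans (cong (filter (is-kept (x Vec.∷ w))) (sym (map-tabulate id Fin.suc)))
                       (filter-map (is-kept (x Vec.∷ w)) Fin.suc (allFin L))

      deletePairs-kept : deletePairs i (x Vec.∷ w) (filter (is-kept (x Vec.∷ w)) (tabulate Fin.suc)) ≡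
                         map Fin.suc (undeleted i w)
      deletePairs-kept = trans (cong (deletePairs i (x Vec.∷ w)) kept-suc) (deletePairs-suc (kept i w))

    undeleted-keep : x ≡ i ⊎ x ≡ suc i →
                     undeleted i (x Vec.∷ w) ≡ push i (x Vec.∷ w) Fin.zero (map Fin.suc (undeleted i w))
    undeleted-keep x∈ = trans (cong (deletePairs i (x Vec.∷ w)) (filter-accept (is-kept (x Vec.∷ w)) {Fin.zero} x∈))
                              (cong (push i (x Vec.∷ w) Fin.zero) deletePairs-kept)

    undeleted-skip : x ≢ i → x ≢ suc i → undeleted i (x Vec.∷ w) ≡ map Fin.suc (undeleted i w)
    undeleted-skip ≢i ≢i+1 =
      trans (cong (deletePairs i (x Vec.∷ w))
               (filter-reject (is-kept (x Vec.∷ w)) {Fin.zero} λ { (inj₁ ≡i) → ≢i ≡i ; (inj₂ ≡i+1) → ≢i+1 ≡i+1 }))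
            deletePairs-kept

    exposed-suc : ∀ {p y a a′} → (∀ {u} → Signature u a 0 → Signature (x ∷ u) a′ 0) →
                  Exposed w p y a → Exposed (x Vec.∷ w) (Fin.suc p) y a′
    exposed-suc f (u , v , b , eq , repl , su , sv) =
      x ∷ u , v , b , cong (x ∷_) eq , cong (x ∷_) ∘ repl , f su , sv

    exposed-zero : ∀ {b} → Signature (Vec.toList w) 0 b → Exposed (x Vec.∷ w) Fin.zero x 0
    exposed-zero s = [] , Vec.toList w , _ , refl , (λ _ → refl) , [] , s

    push-nonpair : ∀ p qs → ¬ lookup (x Vec.∷ w) p ≡ suc i ⊎ All (λ q → lookup (x Vec.∷ w) q ≢ i) qs →
                   push i (x Vec.∷ w) p qs ≡ p ∷ qs
    push-nonpair p []       _ = refl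
    push-nonpair p (q ∷ qs) h with is-i+1 i (x Vec.∷ w) p ×-dec is-i i (x Vec.∷ w) q
    push-nonpair p (q ∷ qs) (inj₁ ≢i+1)      | yes (≡i+1 , _) = contradiction ≡i+1 ≢i+1
    push-nonpair p (q ∷ qs) (inj₂ (≢i ∷ _))  | yes (_ , ≡i)   = contradiction ≡i ≢i
    ... | no _ = refl

    push-pair : ∀ p q qs → lookup (x Vec.∷ w) p ≡ suc i → lookup (x Vec.∷ w) q ≡ i →
                push i (x Vec.∷ w) p (q ∷ qs) ≡ qs
    push-pair p q qs p≡ q≡ with is-i+1 i (x Vec.∷ w) p ×-dec is-i i (x Vec.∷ w) q
    ... | yes _ = refl
    ... | no ¬pair = contradiction (p≡ , q≡) ¬pair

  private
    last-suc : ∀ {L p} {P : Pred (Fin (suc L)) p} (ps : List (Fin L)) →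
               MaybeAll.All (P ∘ Fin.suc) (last ps) → MaybeAll.All P (last (map Fin.suc ps))
    last-suc ps h = subst (MaybeAll.All _) (sym (last-map Fin.suc ps)) (MaybeAll.map⁺ h)

    head-suc : ∀ {L p} {P : Pred (Fin (suc L)) p} (ps : List (Fin L)) →
               MaybeAll.All (P ∘ Fin.suc) (head ps) → MaybeAll.All P (head (map Fin.suc ps))
    head-suc ps h = subst (MaybeAll.All _) (sym (head-map ps)) (MaybeAll.map⁺ h)

  -- As `deletePairs` is a right fold, each new first letter acts on the reduced rest. The four
  -- cases follow the rules `lower`, `raise`, `cancel` and `skip`.
  analysis : ∀ {L} (w : Vec ℕ L) → Analysis w
  analysis Vec.[] = record
    { lowers = [] ; raises = [] ; undeleted-≡ = refl ; all-lower = [] ; all-raise = [] ; signature = []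
    ; last-lower = MaybeAll.nothing ; head-raise = MaybeAll.nothing }
  analysis (x Vec.∷ w) with analysis w | x ≟ i | x ≟ suc i
  ... | record { lowers = as ; raises = bs ; undeleted-≡ = eq ; all-lower = as≡ ; all-raise = bs≡
               ; signature = s ; last-lower = la ; head-raise = hb } | yes refl | _ = record
    { lowers      = Fin.zero ∷ map Fin.suc as
    ; raises      = map Fin.suc bs
    ; undeleted-≡ = trans (undeleted-keep i w (inj₁ refl))
        (trans (push-nonpair i w Fin.zero _ (inj₁ (1+n≢n ∘ sym)))
               (cong (Fin.zero ∷_) (trans (cong (map Fin.suc) eq) (map-++ Fin.suc as bs))))
    ; all-lower   = refl ∷ All.map⁺ as≡
    ; all-raise   = All.map⁺ bs≡
    ; signature   = subst₂ (λ a b → Signature (i ∷ Vec.toList w) (suc a) b)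
                      (sym (length-map Fin.suc as)) (sym (length-map Fin.suc bs)) (lower s)
    ; last-lower  = last-lower′ as s la
    ; head-raise  = head-suc bs (MaybeAll.map (exposed-suc i w
                      (subst (λ a → Signature _ (suc a) 0) (sym (length-map Fin.suc as)) ∘ lower)) hb)
    }
    where
    last-lower′ : ∀ as → Signature (Vec.toList w) (length as) (length bs) →
                  MaybeAll.All (λ p → Exposed w p i (pred (length as))) (last as) →
                  MaybeAll.All (λ p → Exposed (i Vec.∷ w) p i (length (map Fin.suc as)))
                               (last (Fin.zero ∷ map Fin.suc as))
    -- The new `i` is the last undeleted one only if `w` has none; otherwise the old last one stays
    -- and gains an `i` on its left.
    last-lower′ []          s h = MaybeAll.just (exposed-zero i w s)
    last-lower′ as@(_ ∷ as′) s h = last-suc as (MaybeAll.map (exposed-suc i w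
      (subst (λ a → Signature _ (suc a) 0) (sym (length-map Fin.suc as′)) ∘ lower)) h)
  ... | record { lowers = [] ; raises = bs ; undeleted-≡ = eq ; all-lower = as≡ ; all-raise = bs≡
               ; signature = s ; last-lower = la ; head-raise = hb } | no _ | yes refl = record
    { lowers      = []
    ; raises      = Fin.zero ∷ map Fin.suc bs
    ; undeleted-≡ = trans (undeleted-keep (suc i) w (inj₂ refl))
        (trans (cong (push i (suc i Vec.∷ w) Fin.zero ∘ map Fin.suc) eq)
               (push-nonpair (suc i) w Fin.zero _
                 (inj₂ (All.map⁺ (All.map (λ ≡i+1 ≡i → 1+n≢n (trans (sym ≡i+1) ≡i)) bs≡)))))
    ; all-lower   = []
    ; all-raise   = refl ∷ All.map⁺ bs≡
    ; signature   = subst (λ b → Signature (suc i ∷ Vec.toList w) 0 (suc b))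
                      (sym (length-map Fin.suc bs)) (raise s)
    ; last-lower  = MaybeAll.nothing
    ; head-raise  = MaybeAll.just (exposed-zero (suc i) w s)
    }
  ... | record { lowers = a ∷ as ; raises = bs ; undeleted-≡ = eq ; all-lower = a≡ ∷ as≡ ; all-raise = bs≡
               ; signature = s ; last-lower = la ; head-raise = hb } | no _ | yes refl = record
    { lowers      = map Fin.suc as
    ; raises      = map Fin.suc bs
    ; undeleted-≡ = trans (undeleted-keep (suc i) w (inj₂ refl))
        (trans (cong (push i (suc i Vec.∷ w) Fin.zero ∘ map Fin.suc) eq)
               (trans (push-pair (suc i) w Fin.zero (Fin.suc a) _ refl a≡) (map-++ Fin.suc as bs)))
    ; all-lower   = All.map⁺ as≡
    ; all-raise   = All.map⁺ bs≡
    ; signature   = subst₂ (Signature (suc i ∷ Vec.toList w))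
                      (sym (length-map Fin.suc as)) (sym (length-map Fin.suc bs)) (cancel s)
    ; last-lower  = last-lower′ as la
    ; head-raise  = head-suc bs (MaybeAll.map (exposed-suc (suc i) w
                      (subst (λ a → Signature _ a 0) (sym (length-map Fin.suc as)) ∘ cancel)) hb)
    }
    where
    last-lower′ : ∀ as → MaybeAll.All (λ p → Exposed w p i (length as)) (last (a ∷ as)) →
                  MaybeAll.All (λ p → Exposed (suc i Vec.∷ w) p i (pred (length (map Fin.suc as))))
                               (last (map Fin.suc as))
    -- The new `i + 1` deletes the first undeleted `i`. If others remain, that first one lies left
    -- of the last, so the cancellation takes place within `u`.
    last-lower′ []           h = MaybeAll.nothing
    last-lower′ as@(_ ∷ as′) h = last-suc as (MaybeAll.map (exposed-suc (suc i) w
      (subst (λ a → Signature _ a 0) (sym (length-map Fin.suc as′)) ∘ cancel)) h)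
  ... | record { lowers = as ; raises = bs ; undeleted-≡ = eq ; all-lower = as≡ ; all-raise = bs≡
               ; signature = s ; last-lower = la ; head-raise = hb } | no ≢i | no ≢i+1 = record
    { lowers      = map Fin.suc as
    ; raises      = map Fin.suc bs
    ; undeleted-≡ = trans (undeleted-skip x w ≢i ≢i+1) (trans (cong (map Fin.suc) eq) (map-++ Fin.suc as bs))
    ; all-lower   = All.map⁺ as≡
    ; all-raise   = All.map⁺ bs≡
    ; signature   = subst₂ (Signature (x ∷ Vec.toList w))
                      (sym (length-map Fin.suc as)) (sym (length-map Fin.suc bs)) (skip ≢i ≢i+1 s)
    ; last-lower  = last-suc as (MaybeAll.map (exposed-suc x w
                      (subst (λ a → Signature _ (pred a) 0) (sym (length-map Fin.suc as)) ∘ skip ≢i ≢i+1)) la)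
    ; head-raise  = head-suc bs (MaybeAll.map (exposed-suc x w
                      (subst (λ a → Signature _ a 0) (sym (length-map Fin.suc as)) ∘ skip ≢i ≢i+1)) hb)
    }

  undeleted-i-≡ : ∀ {L} (w : Vec ℕ L) → undeleted-i i w ≡ Analysis.lowers (analysis w)
  undeleted-i-≡ w = trans (cong (filter (is-i i w)) undeleted-≡) (trans (filter-++ (is-i i w) lowers raises)
    (trans (cong₂ _++_ (filter-all (is-i i w) all-lower)
                       (filter-none (is-i i w) (All.map (λ ≡i+1 ≡i → 1+n≢n (trans (sym ≡i+1) ≡i)) all-raise)))
           (++-identityʳ lowers)))
    where open Analysis (analysis w)

  undeleted-i+1-≡ : ∀ {L} (w : Vec ℕ L) → undeleted-i+1 i w ≡ Analysis.raises (analysis w)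
  undeleted-i+1-≡ w = trans (cong (filter (is-i+1 i w)) undeleted-≡) (trans (filter-++ (is-i+1 i w) lowers raises)
    (cong₂ _++_ (filter-none (is-i+1 i w) (All.map (λ ≡i ≡i+1 → 1+n≢n (trans (sym ≡i+1) ≡i)) all-lower))
                (filter-all (is-i+1 i w) all-raise)))
    where open Analysis (analysis w)

-- Column readings of lists of columns.

reading : List (List ℕ) → List ℕ
reading []       = []
reading (c ∷ cs) = reverse c ++ reading cs

reading-∷ʳ : ∀ cs c → reading (cs ∷ʳ c) ≡ reading cs ++ reverse c
reading-∷ʳ []       c = ++-identityʳ (reverse c)
reading-∷ʳ (b ∷ cs) c = trans (cong (reverse b ++_) (reading-∷ʳ cs c))
                              (sym (++-assoc (reverse b) (reading cs) (reverse c)))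

toList-CR : ∀ {ds} (T : Filling ds) → Vec.toList (CR T) ≡ reading (columns T)
toList-CR []      = refl
toList-CR (c ∷ T) = trans (Vec.toList-++ (Vec.reverse c) (CR T)) (cong₂ _++_ (Vec.toList-reverse c) (toList-CR T))

reading-injective : ∀ {ds} (T T′ : Filling ds) → reading (columns T) ≡ reading (columns T′) → T ≡ T′
reading-injective T T′ eq = CR-injective T T′
  (trans (sym (Vec.cast-is-id refl (CR T)))
    (Vec.toList-injective refl (CR T) (CR T′) (trans (toList-CR T) (trans eq (sym (toList-CR T′))))))

reverse-split : ∀ {a} {A : Set a} {xs : List A} u y v → reverse xs ≡ u ++ y ∷ v →
                xs ≡ reverse v ++ y ∷ reverse u
reverse-split {xs = xs} u y v eq = trans (sym (reverse-involutive xs))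
                                       (trans (cong reverse eq) (reverse-++-∷ u y v))

-- Equal shapes put the changed letter in the same column and row of both fillings. Columns are read
-- upwards, so the entries `β` below it belong to `u` and the entries `α` above it to `v`.
reading-split : ∀ {ds} (T T′ : Filling ds) u {y y′ v} →
  reading (columns T) ≡ u ++ y ∷ v → reading (columns T′) ≡ u ++ y′ ∷ v →
  ∃₂ λ cs₁ cs₂ → ∃₂ λ α β → columns T ≡ cs₁ ++ (α ++ y ∷ β) ∷ cs₂ ×
    columns T′ ≡ cs₁ ++ (α ++ y′ ∷ β) ∷ cs₂ ×
    u ≡ reading cs₁ ++ reverse β × v ≡ reverse α ++ reading cs₂
reading-split []      []        []      ()
reading-split []      []        (_ ∷ _) ()
reading-split (c ∷ T) (c′ ∷ T′) u {y} {y′} eq eq′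
  with ++-split₂ (reverse (Vec.toList c)) (reverse (Vec.toList c′)) u same-length eq eq′
  where
  same-length : length (reverse (Vec.toList c)) ≡ length (reverse (Vec.toList c′))
  same-length = trans (length-reverse (Vec.toList c)) (trans (Vec.length-toList c)
                  (sym (trans (length-reverse (Vec.toList c′)) (Vec.length-toList c′))))
... | inj₁ (t , c≡ , c′≡ , refl , T≡) with reading-injective T T′ T≡
...   | refl = [] , columns T , reverse t , reverse u ,
               cong (_∷ columns T) (reverse-split u y t c≡) , cong (_∷ columns T) (reverse-split u y′ t c′≡) ,
               sym (reverse-involutive u) , cong (_++ reading (columns T)) (sym (reverse-involutive t))
reading-split (c ∷ T) (c′ ∷ T′) u eq eq′ | inj₂ (t , c≡c′ , refl , T≡ , T′≡)
  with reading-split T T′ t T≡ T′≡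
... | cs₁ , cs₂ , α , β , eqT , eqT′ , refl , v≡ =
  Vec.toList c ∷ cs₁ , cs₂ , α , β , cong (Vec.toList c ∷_) eqT ,
  cong₂ _∷_ (sym (reverse-injective c≡c′)) eqT′ ,
  sym (++-assoc (reverse (Vec.toList c)) (reading cs₁) (reverse β)) , v≡

-- The shape is dropped so that the list of columns can be split at the column that changes.
AITableau : ℕ → List (List ℕ) → Set
AITableau n cs = All (All (λ t → 1 ≤ t × t ≤ n)) cs × All (Linked _<_) cs × Linked _≼_ cs × AICondition n cs

-- Changing one entry of a tableau.

module _ (n i : ℕ) (1≤i : 1 ≤ i) (i<n : i < n) where

  -- Only an `i` in the same row of `c` obstructs. The entries of `c` below it are bounded below by
  -- those of `Y`, so they exceed `i + 1` and this `i` would be undeleted. The left side is either a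
  -- column or the complement of the first column.
  raise-entry : ∀ X {Y Z c w b} → Linked _<_ c → All (suc i <_) Y → All (Neutral i) Z →
                Signature i (Z ++ reverse c ++ w) 0 b → X ++ i ∷ Y ≼ c → X ++ suc i ∷ Y ≼ c
  raise-entry X {Z = Z} {w = w} {b} strict Y> nZ s r with ≼-splitʳ X r
  ... | inj₁ repl = repl
  ... | inj₂ (X′ , z , Y′ , refl , i≤z , Y≼Y′ , repl) with m≤n⇒m<n∨m≡n i≤z
  ...   | inj₁ i<z  = repl i<z
  ...   | inj₂ refl = contradiction
    (subst (λ v → Signature i v 0 b)
      (trans (cong (λ v → Z ++ v ++ w) (reverse-++-∷ X′ i Y′))
        (trans (cong (Z ++_) (++-assoc (reverse Y′) (i ∷ reverse X′) w)) (sym (++-assoc Z (reverse Y′) _)))) s)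
    (undeleted-lower i (All.++⁺ nZ (All-reverse (neutral-> i (≼-All-> Y≼Y′ Y>)))))

  -- Only an `i + 1` of `c` in the same row obstructs, and the entries above it are below `i`. The
  -- hypothesis `absent` is discharged by an undeleted `i + 1` when `c` is a column and by parity
  -- when `c` is a complement.
  lower-entry : ∀ X {Y c} → All (_< i) X → (∀ X′ Y′ → All (_< i) X′ → ¬ c ≡ X′ ++ suc i ∷ Y′) →
                c ≼ X ++ suc i ∷ Y → c ≼ X ++ i ∷ Y
  lower-entry X X< absent r with ≼-splitˡ X r
  ... | X′ , z , Y′ , eq , z≤i+1 , X′< , repl with m≤n⇒m<n∨m≡n z≤i+1
  ...   | inj₁ z<i+1 = repl (s≤s⁻¹ z<i+1)
  ...   | inj₂ refl  = contradiction eq (absent X′ Y′ (X′< X<))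

  raise-≼ : ∀ X {x y Y c} → x ≤ y → c ≼ X ++ x ∷ Y → c ≼ X ++ y ∷ Y
  raise-≼ X x≤y r with ≼-splitˡ X r
  ... | _ , _ , _ , _ , z≤x , _ , repl = repl (≤-trans z≤x x≤y)

  lower-≼ : ∀ X {x y Y c} → x ≤ y → X ++ y ∷ Y ≼ c → X ++ x ∷ Y ≼ c
  lower-≼ X x≤y r with ≼-splitʳ X r
  ... | inj₁ repl = repl
  ... | inj₂ (_ , _ , _ , _ , y≤z , _ , repl) = repl (≤-trans x≤y y≤z)

  module _ {α β : List ℕ} (α< : All (_< i) α) (β> : All (suc i <_) β) where

    raise-AI : ∀ P Q → AICondition n (P ++ (α ++ i ∷ β) ∷ Q) → AICondition n (P ++ (α ++ suc i ∷ β) ∷ Q)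
    raise-AI []          []      _  = tt
    raise-AI []          (_ ∷ _) ai with complement-swap 1≤i i<n α< β>
    ... | γ , δ , eq , eq′ , _ =
      subst (_≼ _) (sym eq′) (lower-≼ γ (n≤1+n i) (subst (_≼ _) eq ai))
    raise-AI (_ ∷ [])    _       ai = raise-≼ α (n≤1+n i) ai
    raise-AI (_ ∷ _ ∷ _) _       ai = ai

    lower-AI : ∀ {a b} P Q → Signature i (reading P ++ reverse β) a 0 →
               Signature i (reverse α ++ reading Q) 0 b →
               2 ∣ a → All (Linked _<_) P → All (Linked _<_) Q →
               AICondition n (P ++ (α ++ suc i ∷ β) ∷ Q) → AICondition n (P ++ (α ++ i ∷ β) ∷ Q)
    lower-AI []          []      _  _  _   _            _            _  = tt
    lower-AI []          (_ ∷ _) _  sʳ _   _            (strict ∷ _) ai with complement-swap 1≤i i<n α< β>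
    -- Lowering the first column raises `i` to `i + 1` in its complement, so the second column must
    -- have no `i` in that row.
    ... | γ , δ , eq , eq′ , δ> = subst (_≼ _) (sym eq)
      (raise-entry γ strict δ> (All-reverse (neutral-< i α<)) sʳ (subst (_≼ _) eq′ ai))
    lower-AI {a} (c ∷ []) _       sˡ _  2∣a (strict ∷ _) _            ai = lower-entry α α< absent ai
      where
      -- Here the complement contains `i + 1` but not `i`, so `c` contains `i` but not `i + 1`. This
      -- `i` is the only relevant letter before the changed one, whence `a` is 1, which is not even.
      absent : ∀ X Y → All (_< i) X → ¬ complement n c ≡ X ++ suc i ∷ Y
      absent X Y X< eq with ∈-∃++ i∈c
        where
        i∉ : i ∉ˡ X ++ suc i ∷ Y
        i∉ i∈ with ∈-++⁻ X i∈
        ... | inj₁ i∈X         = <-irrefl refl (All.lookup X< i∈X)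
        ... | inj₂ (here ≡)    = 1+n≢n (sym ≡)
        ... | inj₂ (there i∈Y) = <-asym (n<1+n i) (All.lookup
          (proj₁ (proj₂ (strict-split X (subst (Linked _<_) eq (complement-strict n c))))) i∈Y)
        i∈c : i ∈ˡ c
        i∈c = decidable-stable (i ∈? c)
          (λ i∉c → i∉ (subst (i ∈ˡ_) eq (∈-filter⁺ (_∉? c) (∈-[1…] 1≤i (<⇒≤ i<n)) i∉c)))
      ... | c₁ , c₂ , refl with strict-split c₁ strict
      ...   | c₁< , c₂> , _ = contradiction (∣1⇒≡1 (subst (2 ∣_) a≡1 2∣a)) λ()
        where
        i+1∉c : suc i ∉ˡ c
        i+1∉c = proj₂ (∈-filter⁻ (_∉? c) {xs = [1… n ]} (subst (suc i ∈ˡ_) (sym eq) (∈-++⁺ʳ X (here refl))))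
        c₂-neutral : All (Neutral i) c₂
        c₂-neutral = All.tabulate (λ x∈ → >⇒≢ (All.lookup c₂> x∈) , λ { refl → i+1∉c (∈-++⁺ʳ c₁ (there x∈)) })
        a≡1 : a ≡ 1
        a≡1 = signature-single-lower i (All-reverse c₂-neutral)
          (All.++⁺ (All-reverse (neutral-< i c₁<)) (All-reverse (neutral-> i β>)))
          (subst (λ v → Signature i v a 0)
            (trans (cong (_++ reverse β) (trans (++-identityʳ (reverse c)) (reverse-++-∷ c₁ i c₂)))
                   (++-assoc (reverse c₂) (i ∷ reverse c₁) (reverse β))) sˡ)
    lower-AI (_ ∷ _ ∷ _) _       _  _  _   _            _            ai = ai

  module _ (P : List (List ℕ)) (α β : List ℕ) (Q : List (List ℕ)) {a b : ℕ}
           (sˡ : Signature i (reading P ++ reverse β) a 0)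
           (sʳ : Signature i (reverse α ++ reading Q) 0 b) where

    -- The comparison with the left neighbour is only relaxed. Strictness below the entry comes from
    -- `sˡ`, and the comparison with the right neighbour from `sʳ`.
    raise-AITableau : AITableau n (P ++ (α ++ i ∷ β) ∷ Q) → AITableau n (P ++ (α ++ suc i ∷ β) ∷ Q)
    raise-AITableau (letters , strict , rows , ai)
      with All.++⁻ P strict
    ... | _ , column ∷ strictʳ with strict-split α column
    ...   | α< , β≥ , _ , β-strict =
      All-replace P letters (All-replace α (All-middle P letters) (s≤s z≤n , i<n)) ,
      All-replace P strict (Linked-replace α column (λ _ → m<n⇒m<1+n) (λ { refl _ → All.head β> })) ,
      Linked-replace P rows (λ _ → raise-≼ α (n≤1+n i)) raise-right ,
      raise-AI α< β> P Q ai
      where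
      β> : All (suc i <_) β
      β> = signature-raises-> i (reading P) β-strict β≥ sˡ
      raise-right : ∀ {c cs} → Q ≡ c ∷ cs → α ++ i ∷ β ≼ c → α ++ suc i ∷ β ≼ c
      raise-right refl = raise-entry α (All.head strictʳ) β> (All-reverse (neutral-< i α<)) sʳ

    -- Dually, strictness above the entry comes from `sʳ` and the comparison with the left neighbour
    -- from `sˡ`. The parity of `a` enters only through the AI-condition.
    lower-AITableau : 2 ∣ a → AITableau n (P ++ (α ++ suc i ∷ β) ∷ Q) → AITableau n (P ++ (α ++ i ∷ β) ∷ Q)
    lower-AITableau 2∣a (letters , strict , rows , ai)
      with All.++⁻ P strict
    ... | strictˡ , column ∷ strictʳ with strict-split α column
    ...   | α≤ , β> , α-strict , _ =
      All-replace P letters (All-replace α (All-middle P letters) (1≤i , <⇒≤ i<n)) ,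
      All-replace P strict
        (Linked-replace α column (λ { refl _ → proj₂ (All.∷ʳ⁻ α<) }) (λ _ → <-trans (n<1+n i))) ,
      Linked-replace P rows lower-left (λ _ → lower-≼ α (n≤1+n i)) ,
      lower-AI α< β> P Q sˡ sʳ 2∣a strictˡ strictʳ ai
      where
      α< : All (_< i) α
      α< = signature-lowers-< i α-strict α≤ sʳ
      lower-left : ∀ {cs c} → P ≡ cs ∷ʳ c → c ≼ α ++ suc i ∷ β → c ≼ α ++ i ∷ β
      -- Between an `i + 1` in that row of the left column and the changed letter, the reading
      -- contains only `X` and `β`, which are neutral, so that `i + 1` would be undeleted in `u`.
      lower-left {cs} refl = lower-entry α α< λ { X Y X< refl →
        undeleted-raise i (reading cs ++ reverse Y)
          (All.++⁺ (All-reverse (neutral-< i X<)) (All-reverse (neutral-> i β>)))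
          (subst (λ u → Signature i u a 0) (begin
            reading (cs ∷ʳ (X ++ suc i ∷ Y)) ++ reverse β
              ≡⟨ cong (_++ reverse β) (reading-∷ʳ cs (X ++ suc i ∷ Y)) ⟩
            (reading cs ++ reverse (X ++ suc i ∷ Y)) ++ reverse β
              ≡⟨ cong (λ r → (reading cs ++ r) ++ reverse β) (reverse-++-∷ X (suc i) Y) ⟩
            (reading cs ++ reverse Y ++ suc i ∷ reverse X) ++ reverse β
              ≡⟨ cong (_++ reverse β) (sym (++-assoc (reading cs) (reverse Y) (suc i ∷ reverse X))) ⟩
            ((reading cs ++ reverse Y) ++ suc i ∷ reverse X) ++ reverse β
              ≡⟨ ++-assoc (reading cs ++ reverse Y) (suc i ∷ reverse X) (reverse β) ⟩
            (reading cs ++ reverse Y) ++ suc i ∷ reverse X ++ reverse β ∎) sˡ) }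
        where open ≡-Reasoning

-- `B̃` branches on a Boolean; matching on the decision behind it hands the evenness of `φ` to the
-- first branch.
if-⊔0 : ∀ {d a p} {D : Set d} {A : Set a} {P : Pred A p} (D? : Dec D) {x y : Maybe A} →
        (D → x ∈ P ⊔0) → y ∈ P ⊔0 → (if does D? then x else y) ∈ P ⊔0
if-⊔0 (yes d) x∈ y∈ = x∈ d
if-⊔0 (no _)  x∈ y∈ = y∈

-- The operators on tableaux.

module _ {ds n i} (1≤i : 1 ≤ i) (i<n : i < n) (T : Filling ds)
         (T-AI : IsSST n T × AICondition n (columns T)) where

  private
    w : Vec ℕ _
    w = CR T

    open Analysis (analysis i w)

    SST-AI′ : Filling ds → Set
    SST-AI′ T = IsSST n T × AICondition n (columns T)

    φ≡ : φ i T ≡ length lowers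
    φ≡ = cong length (undeleted-i-≡ i w)

    -- The step shared by both operators: an exposed position of the reading is located in a column,
    -- and the change of that entry is carried back to a filling of the same shape.
    transfer : ∀ {p y y′ a} →
      (∀ P α β Q {b} → Signature i (reading P ++ reverse β) a 0 →
        Signature i (reverse α ++ reading Q) 0 b →
        AITableau n (P ++ (α ++ y ∷ β) ∷ Q) → AITableau n (P ++ (α ++ y′ ∷ β) ∷ Q)) →
      Exposed i w p y a → SST-AI′ (fromCR ds (w [ p ]≔ y′))
    transfer {p} {y} {y′} preserve (u , v , b , eq , repl , su , sv)
      with reading-split T (fromCR ds (w [ p ]≔ y′)) u
             (trans (sym (toList-CR T)) eq)
             (trans (sym (toList-CR (fromCR ds (w [ p ]≔ y′))))
                    (trans (cong Vec.toList (CR-fromCR ds (w [ p ]≔ y′))) (repl y′)))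
    ... | P , Q , α , β , eqT , eqT′ , refl , refl
      with subst (AITableau n) (sym eqT′) (preserve P α β Q su sv (subst (AITableau n) eqT
             (IsSST.letters (proj₁ T-AI) , IsSST.columnsStrict (proj₁ T-AI) ,
              IsSST.rowsWeak (proj₁ T-AI) , proj₂ T-AI)))
    ...   | letters , strict , rows , ai =
      record { letters = letters ; columnsStrict = strict ; rowsWeak = rows } , ai

  Ẽ-SST-AI : 2 ∣ φ i T → Ẽ i T ∈ SST-AI′ ⊔0
  Ẽ-SST-AI 2∣φ = MaybeAll.map⁺ (MaybeAll.map⁺ (subst (MaybeAll.All _) (cong head (sym (undeleted-i+1-≡ i w)))
    (MaybeAll.map (transfer (λ P α β Q sˡ sʳ →
      -- For the first undeleted `i + 1` the count `a` is `length lowers`, that is, `φ` itself, so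
      -- the evenness of `φ` is what is required.
      lower-AITableau n i 1≤i i<n P α β Q sˡ sʳ (subst (2 ∣_) φ≡ 2∣φ))) head-raise)))

  F̃-SST-AI : F̃ i T ∈ SST-AI′ ⊔0
  F̃-SST-AI = MaybeAll.map⁺ (MaybeAll.map⁺ (subst (MaybeAll.All _) (cong last (sym (undeleted-i-≡ i w)))
    (MaybeAll.map (transfer (λ P α β Q sˡ sʳ → raise-AITableau n i 1≤i i<n P α β Q sˡ sʳ)) last-lower)))

proposition2p5p11 : (n : ℕ) → 3 ≤ n → (ρ : Par (n / 2)) →
    ∀ T → T ∈ SST-AI n (partition ρ) →
    (i : ℕ) → 1 ≤ i → i < n →
    B̃ i T ∈ SST-AI n (partition ρ) ⊔0
proposition2p5p11 n _ ρ T T∈ i 1≤i i<n =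
  if-⊔0 (2 ∣? φ i T) (Ẽ-SST-AI 1≤i i<n T T∈) (F̃-SST-AI 1≤i i<n T T∈)
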